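{- Let $T$ be a minimal element of the poset $\mathcal{AFT}$. Then $T$ is isomorphic to $E_7$.
   Context: All graphs are finite and simple. An automorphism of a graph $G$ is a bijection $\phi: V(G)\to V(G)$ with $uv\in E(G)$ iff $\phi(u)\phi(v)\in E(G)$; the identity is the trivial automorphism. A tree $T$ with $|V(T)|\ge 2$ is automorphism-free if it has no non-trivial automorphism. $\mathcal{AFT}$ is the poset whose elements are all finite automorphism-free trees (up to isomorphism), ordered by $T_1\preceq T_2$ if $T_1$ can be obtained from $T_2$ by successively deleting one leaf at a time in such a way that each intermediate tree is also automorphism-free. A minimal element is a $T\in\mathcal{AFT}$ such that no $T'\in\mathcal{AFT}$ with $T'\ne T$ satisfies $T'\preceq T$. $E_7$ is the tree on 7 vertices consisting of a vertex $c$ of degree three together with three paths attached at $c$ having $1$, $2$ and $3$ vertices respectively (i.e. the spider with legs of lengths $1,2,3$). -}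

module Defs where

open import Data.Nat using (ℕ; zero; suc; _≤_; _≡ᵇ_)
open import Data.Fin using (Fin; toℕ; punchIn)
open import Data.Bool using (Bool; true; false; _∧_; _∨_)
open import Data.List using (List; []; _∷_; length)
open import Data.Bool.ListAction using (any)
open import Data.List.Relation.Unary.Unique.Propositional using (Unique)
open import Data.Product using (Σ; ∃; _×_; _,_)
open import Relation.Binary.PropositionalEquality using (_≡_)
open import Relation.Nullary using (¬_)
open import Function.Bundles using (_↔_; Inverse)

record Graph (n : ℕ) : Set where
  field
    adj     : Fin n → Fin n → Bool
    sym     : ∀ u v → adj u v ≡ adj v u
    irrefl  : ∀ u → adj u u ≡ false
open Graph public

Adj : ∀ {n} → Graph n → Fin n → Fin n → Set
Adj G u v = adj G u v ≡ true

data Walk {n} (G : Graph n) : Fin n → Fin n → Set where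
  here : ∀ {u} → Walk G u u
  step : ∀ {u v w} → Adj G u v → Walk G v w → Walk G u w

Connected : ∀ {n} → Graph n → Set
Connected G = ∀ u v → Walk G u v

PathAdj : ∀ {n} → Graph n → Fin n → List (Fin n) → Fin n → Set
PathAdj G a []       z = Adj G a z
PathAdj G a (b ∷ bs) z = Adj G a b × PathAdj G b bs z

IsCycle : ∀ {n} → Graph n → List (Fin n) → Set
IsCycle G []       = Data.Empty.⊥ where import Data.Empty
IsCycle G (v ∷ vs) = Unique (v ∷ vs) × (3 ≤ length (v ∷ vs)) × PathAdj G v vs v

Acyclic : ∀ {n} → Graph n → Set
Acyclic G = ∀ cs → ¬ IsCycle G cs

IsTree : ∀ {n} → Graph n → Set
IsTree G = Connected G × Acyclic G

IsAutomorphism : ∀ {n} → Graph n → (Fin n ↔ Fin n) → Set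
IsAutomorphism G φ = ∀ u v → adj G u v ≡ adj G (Inverse.to φ u) (Inverse.to φ v)

AutomorphismFree : ∀ {n} → Graph n → Set
AutomorphismFree G = ∀ φ → IsAutomorphism G φ → ∀ u → Inverse.to φ u ≡ u

AFT : ∀ {n} → Graph n → Set
AFT {n} G = 2 ≤ n × IsTree G × AutomorphismFree G

_≅_ : ∀ {m n} → Graph m → Graph n → Set
_≅_ {m} {n} G H = Σ (Fin m ↔ Fin n) λ φ →
  ∀ u v → adj G u v ≡ adj H (Inverse.to φ u) (Inverse.to φ v)

delete : ∀ {n} → Graph (suc n) → Fin (suc n) → Graph n
delete G v = record
  { adj    = λ i j → adj G (punchIn v i) (punchIn v j)
  ; sym    = λ i j → sym G (punchIn v i) (punchIn v j)
  ; irrefl = λ i → irrefl G (punchIn v i) }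

IsLeaf : ∀ {n} → Graph n → Fin n → Set
IsLeaf G v = Σ _ λ u → Adj G v u × (∀ w → Adj G v w → w ≡ u)

data _⪯_ {m} (G : Graph m) : ∀ {n} → Graph n → Set where
  done : ∀ {n} {H : Graph n} → G ≅ H → G ⪯ H
  del  : ∀ {n} {H : Graph (suc n)} (v : Fin (suc n)) → IsLeaf H v →
         AFT (delete H v) → G ⪯ delete H v → G ⪯ H

Minimal : ∀ {n} → Graph n → Set
Minimal {n} T = AFT T ×
  (∀ {m} (T′ : Graph m) → AFT T′ → T′ ⪯ T → T′ ≅ T)

-- E₇: centre 0; legs 0-1 ; 0-2-3 ; 0-4-5-6.
E7-edges : List (ℕ × ℕ)
E7-edges = (0 , 1) ∷ (0 , 2) ∷ (2 , 3) ∷ (0 , 4) ∷ (4 , 5) ∷ (5 , 6) ∷ []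

E7-adj : Fin 7 → Fin 7 → Bool
E7-adj u v = any (λ { (a , b) → ((toℕ u ≡ᵇ a) ∧ (toℕ v ≡ᵇ b)) ∨ ((toℕ u ≡ᵇ b) ∧ (toℕ v ≡ᵇ a)) }) E7-edges

E7 : Graph 7
E7 = record { adj = E7-adj ; sym = sym′ ; irrefl = irr }
  where
  open import Data.Fin using (zero; suc)
  open import Relation.Binary.PropositionalEquality using (refl)
  irr : ∀ u → E7-adj u u ≡ false
  irr zero = refl
  irr (suc zero) = refl
  irr (suc (suc zero)) = refl
  irr (suc (suc (suc zero))) = refl
  irr (suc (suc (suc (suc zero)))) = refl
  irr (suc (suc (suc (suc (suc zero))))) = refl
  irr (suc (suc (suc (suc (suc (suc zero)))))) = refl
  sym′ : ∀ u v → E7-adj u v ≡ E7-adj v u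
  sym′ u v = lem E7-edges
    where
    open import Data.Bool.Properties using (∧-comm; ∨-comm)
    open import Relation.Binary.PropositionalEquality using (cong₂)
    lem : ∀ es → any (λ { (a , b) → ((toℕ u ≡ᵇ a) ∧ (toℕ v ≡ᵇ b)) ∨ ((toℕ u ≡ᵇ b) ∧ (toℕ v ≡ᵇ a)) }) es
               ≡ any (λ { (a , b) → ((toℕ v ≡ᵇ a) ∧ (toℕ u ≡ᵇ b)) ∨ ((toℕ v ≡ᵇ b) ∧ (toℕ u ≡ᵇ a)) }) es
    lem [] = refl
    lem ((a , b) ∷ es) = cong₂ _∨_
      (Relation.Binary.PropositionalEquality.trans
        (∨-comm ((toℕ u ≡ᵇ a) ∧ (toℕ v ≡ᵇ b)) ((toℕ u ≡ᵇ b) ∧ (toℕ v ≡ᵇ a)))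
        (cong₂ _∨_ (∧-comm (toℕ u ≡ᵇ b) (toℕ v ≡ᵇ a)) (∧-comm (toℕ u ≡ᵇ a) (toℕ v ≡ᵇ b))))
      (lem es)
      where import Relation.Binary.PropositionalEquality

{-# OPTIONS --safe #-}
module Submission where

-- Rooted at a centroid, a tree with no rooted automorphism is automorphism-free
-- as soon as the centroid is unique, or the two halves of a bicentroidal tree
-- are not isomorphic. A rooted automorphism-free tree stays so when a leaf is
-- deleted by descending into a smallest branch each time. Suppose no leaf
-- deletion of the automorphism-free tree T is automorphism-free, and let B be
-- the largest branch at a centroid, R the rest of T (which contains the
-- centroid), and t ◁ • the tree t with a new root joined to its old root.
--
-- If |R| > |B| + 1, pruning T leaves the centroid unique, a contradiction.
--
-- If |R| = |B|, every deletion B′ of B must satisfy R ≅ B′ ◁ • and every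
-- deletion R′ of R must satisfy B ≅ R′ ◁ •. Descending through such deletions
-- gives B ≅ R, a contradiction.
--
-- If |R| = |B| + 1, every deletion R′ of R is isomorphic to B. Let c be the
-- smallest branch of R at the centroid and w the rest of R. If w is a single
-- vertex, B and c force each other as before; if c has at least two vertices,
-- pruning B makes the centroid unique. So c is a leaf and B ≅ w; pruning B to
-- P forces w ≅ P ◁ •. Deleting from that copy of P in R instead gives
-- a contradiction when |B| ≥ 4, |B| ≤ 2 is too small, and |B| = 3 is E₇.

open import Defs

open import Data.Bool as Bool using (true)
open import Data.Bool.Properties using (⇔→≡)
open import Data.Empty using (⊥-elim)
open import Data.Fin as Fin using (Fin; zero; suc; punchIn; punchOut)
open import Data.Fin.Patterns using (0F; 1F; 2F; 3F; 4F; 5F; 6F)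
open import Data.Fin.Permutation using (↔⇒≡)
open import Data.Fin.Properties
  using (+↔⊎; all?; any?; injective⇒≤; punchIn-injective; punchIn-punchOut; punchInᵢ≢i)
open import Data.List using (List; []; _∷_; _++_; length; lookup; map)
open import Data.List.Properties using (length-map)
open import Data.List.Membership.Propositional.Properties using (∈-lookup; ∈-∃++)
open import Data.List.Membership.DecPropositional using (_∈?_)
open import Data.List.Relation.Unary.All as All using ([]; _∷_)
open import Data.List.Relation.Unary.All.Properties as All using (¬Any⇒All¬)
open import Data.List.Relation.Unary.AllPairs using ([]; _∷_)
open import Data.List.Relation.Unary.Linked using (Linked; [-]; _∷_)
open import Data.List.Relation.Unary.Unique.Propositional using (Unique)
import Data.List.Relation.Unary.Unique.Propositional.Properties as Unique
open import Data.Maybe as Maybe using (Maybe; just; nothing)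
open import Data.Maybe.Properties using (just-injective)
open import Data.Nat using (ℕ; zero; suc; _+_; _≤_; _<_; _≥_; _≤?_; z≤n; s≤s)
open import Data.Nat.Properties
open import Data.Product using (Σ; ∃; ∃₂; _×_; _,_; proj₁; proj₂)
open import Data.Sum using (_⊎_; inj₁; inj₂; reduce)
open import Data.Sum.Function.Propositional using (_⊎-↔_)
open import Function using (_∘_; id)
open import Function.Bundles using (_↔_; Inverse; mk↔ₛ′; mk⇔)
open import Function.Construct.Composition using (_↔-∘_)
open import Function.Construct.Symmetry using (↔-sym)
open import Relation.Binary.Definitions using (tri<; tri≈; tri>)
open import Relation.Binary.PropositionalEquality
  using (_≡_; _≢_; refl; trans; cong; cong₂; subst; subst₂)
  renaming (sym to ≡-sym)
open import Relation.Nullary using (¬_; Dec; yes; no)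
open import Relation.Nullary.Decidable
  using (¬?; _×-dec_; _→-dec_; decidable-stable; from-yes; map′)

-- Isomorphisms and embeddings of binary relations.

infix 4 _≃_

record _≃_ {A B : Set} (R : A → A → Set) (S : B → B → Set) : Set where
  field
    to      : A → B
    from    : B → A
    to-from : ∀ b → to (from b) ≡ b
    from-to : ∀ a → from (to a) ≡ a
    pres    : ∀ {x y} → R x y → S (to x) (to y)
    pres⁻   : ∀ {x y} → S x y → R (from x) (from y)

  to-injective : ∀ {x y} → to x ≡ to y → x ≡ y
  to-injective {x} {y} eq = trans (≡-sym (from-to x)) (trans (cong from eq) (from-to y))

open _≃_

module _ {A : Set} {R : A → A → Set} where

  ≃-refl : R ≃ R
  ≃-refl = record
    { to = id ; from = id ; to-from = λ _ → refl ; from-to = λ _ → refl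
    ; pres = id ; pres⁻ = id }

module _ {A B : Set} {R : A → A → Set} {S : B → B → Set} where

  ≃-sym : R ≃ S → S ≃ R
  ≃-sym φ = record
    { to = from φ ; from = to φ ; to-from = from-to φ ; from-to = to-from φ
    ; pres = pres⁻ φ ; pres⁻ = pres φ }

  ≃-trans : ∀ {C : Set} {Q : C → C → Set} → R ≃ S → S ≃ Q → R ≃ Q
  ≃-trans φ ψ = record
    { to      = to ψ ∘ to φ
    ; from    = from φ ∘ from ψ
    ; to-from = λ c → trans (cong (to ψ) (to-from φ (from ψ c))) (to-from ψ c)
    ; from-to = λ a → trans (cong (from φ) (from-to ψ (to φ a))) (from-to φ a)
    ; pres    = pres ψ ∘ pres φ
    ; pres⁻   = pres⁻ φ ∘ pres⁻ ψ }

  from-≡ : (φ : R ≃ S) → ∀ {x y} → to φ x ≡ y → from φ y ≡ x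
  from-≡ φ {x} refl = from-to φ x

record _↪_ {A B : Set} (R : A → A → Set) (S : B → B → Set) : Set where
  field
    emb       : A → B
    injective : ∀ {x y} → emb x ≡ emb y → x ≡ y
    preserves : ∀ {x y} → R x y → S (emb x) (emb y)
    reflects  : ∀ {x y} → S (emb x) (emb y) → R x y

open _↪_

module _ {A B A′ B′ : Set}
  {R : A → A → Set} {S : B → B → Set} {R′ : A′ → A′ → Set} {S′ : B′ → B′ → Set}
  (i : R ↪ R′) (j : S ↪ S′) (φ : R′ ≃ S′)
  (f : ∀ a → ∃ λ b → to φ (emb i a) ≡ emb j b)
  (g : ∀ b → ∃ λ a → from φ (emb j b) ≡ emb i a) where

  -- `f` and `g` say that `φ` and its inverse match the images of `i` and `j`. This cuts
  -- isomorphisms down to branches and to graphs with a leaf deleted.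
  restrict : R ≃ S
  restrict = record
    { to      = proj₁ ∘ f
    ; from    = proj₁ ∘ g
    ; to-from = λ b → injective j (trans (≡-sym (proj₂ (f (proj₁ (g b)))))
                  (trans (cong (to φ) (≡-sym (proj₂ (g b)))) (to-from φ _)))
    ; from-to = λ a → injective i (trans (≡-sym (proj₂ (g (proj₁ (f a)))))
                  (trans (cong (from φ) (≡-sym (proj₂ (f a)))) (from-to φ _)))
    ; pres    = λ {x} {y} r → reflects j
                  (subst₂ S′ (proj₂ (f x)) (proj₂ (f y)) (pres φ (preserves i r)))
    ; pres⁻   = λ {x} {y} r → reflects i
                  (subst₂ R′ (proj₂ (g x)) (proj₂ (g y)) (pres⁻ φ (preserves j r))) }

module _ {A B : Set} {R : A → A → Set} {S : B → B → Set} where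

  ↪-surjective⇒≃ : (i : R ↪ S) → (∀ b → ∃ λ a → b ≡ emb i a) → R ≃ S
  ↪-surjective⇒≃ i sur = record
    { to      = emb i
    ; from    = proj₁ ∘ sur
    ; to-from = λ b → ≡-sym (proj₂ (sur b))
    ; from-to = λ a → injective i (≡-sym (proj₂ (sur (emb i a))))
    ; pres    = preserves i
    ; pres⁻   = λ {x} {y} r → reflects i (subst₂ S (proj₂ (sur x)) (proj₂ (sur y)) r) }

AF : ∀ {A : Set} → (A → A → Set) → Set
AF R = ∀ (φ : R ≃ R) x → to φ x ≡ x

AF-resp-≃ : ∀ {A B : Set} {R : A → A → Set} {S : B → B → Set} → R ≃ S → AF R → AF S
AF-resp-≃ θ af φ x = trans (≡-sym (to-from θ (to φ x)))
  (trans (cong (λ z → to θ (from θ (to φ z))) (≡-sym (to-from θ x)))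
  (trans (cong (to θ) (af (≃-trans θ (≃-trans φ (≃-sym θ))) (from θ x))) (to-from θ x)))

-- The new leaf is nothing, and it hangs at q.
data Add {A : Set} (R : A → A → Set) (q : A) : Maybe A → Maybe A → Set where
  old : ∀ {x y} → R x y → Add R q (just x) (just y)
  fwd : Add R q (just q) nothing
  bwd : Add R q nothing (just q)

module _ {A : Set} {R : A → A → Set} {q : A} where

  just-↪ : R ↪ Add R q
  just-↪ = record
    { emb = just ; injective = just-injective ; preserves = old ; reflects = λ { (old r) → r } }

Add-cong : ∀ {A B : Set} {R : A → A → Set} {S : B → B → Set} {q} (φ : R ≃ S) →
           Add R q ≃ Add S (to φ q)
Add-cong {R = R} {S} {q} φ = record
  { to      = λ { (just x) → just (to φ x) ; nothing → nothing }
  ; from    = λ { (just x) → just (from φ x) ; nothing → nothing }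
  ; to-from = λ { (just x) → cong just (to-from φ x) ; nothing → refl }
  ; from-to = λ { (just x) → cong just (from-to φ x) ; nothing → refl }
  ; pres    = λ { (old r) → old (pres φ r) ; fwd → fwd ; bwd → bwd }
  ; pres⁻   = λ { (old r) → old (pres⁻ φ r)
                ; fwd → subst (λ z → Add R q (just z) nothing) (≡-sym (from-to φ q)) fwd
                ; bwd → subst (λ z → Add R q nothing (just z)) (≡-sym (from-to φ q)) bwd } }

-- Rooted trees as graphs.

-- Rooted trees: s ◁ t is t with s hung below its root by a new edge, so that
-- the children of t are the s occurring along its right spine.
infixr 5 _◁_

data Tree : Set where
  •   : Tree
  _◁_ : Tree → Tree → Tree

size : Tree → ℕ
size •       = 1
size (s ◁ t) = size s + size t

data V : Tree → Set where
  pt  : V •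
  inl : ∀ {s t} → V s → V (s ◁ t)
  inr : ∀ {s t} → V t → V (s ◁ t)

inl-injective : ∀ {s t} {x y : V s} → inl {s} {t} x ≡ inl y → x ≡ y
inl-injective refl = refl

inr-injective : ∀ {s t} {x y : V t} → inr {s} {t} x ≡ inr y → x ≡ y
inr-injective refl = refl

root : ∀ t → V t
root •       = pt
root (s ◁ t) = inr (root t)

-- `up` and `down` carry equations instead of having `root` in their indices, so that matching on an
-- edge need not unify with a function call.
data E : ∀ {t} → V t → V t → Set where
  left  : ∀ {s t} {x y : V s} → E x y → E (inl {s} {t} x) (inl y)
  right : ∀ {s t} {x y : V t} → E x y → E (inr {s} {t} x) (inr y)
  up    : ∀ {s t} {x y} → x ≡ root s → y ≡ root t → E (inl {s} {t} x) (inr y)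
  down  : ∀ {s t} {x y} → y ≡ root s → x ≡ root t → E (inr {s} {t} x) (inl y)

E-irrefl : ∀ {t} {x : V t} → ¬ E x x
E-irrefl (left e)  = E-irrefl e
E-irrefl (right e) = E-irrefl e

inl-↪ : ∀ {s t} → E {s} ↪ E {s ◁ t}
inl-↪ = record
  { emb = inl ; injective = inl-injective ; preserves = left ; reflects = λ { (left e) → e } }

inr-↪ : ∀ {s t} → E {t} ↪ E {s ◁ t}
inr-↪ = record
  { emb = inr ; injective = inr-injective ; preserves = right ; reflects = λ { (right e) → e } }

connected : ∀ {t} (P : V t → Set) → P (root t) → (∀ {x y} → E x y → P x → P y) → ∀ x → P x
connected P p₀ next pt      = p₀
connected P p₀ next (inr x) = connected (P ∘ inr) p₀ (next ∘ right) x
connected P p₀ next (inl x) =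
  connected (P ∘ inl) (next (down refl refl) p₀) (next ∘ left) x

-- Rooted and unrooted isomorphism of trees.

infix 4 _~_ _≈_

_~_ : Tree → Tree → Set
s ~ t = E {s} ≃ E {t}

record _≈_ (s t : Tree) : Set where
  constructor rooted
  field
    iso    : s ~ t
    root-≡ : to iso (root s) ≡ root t

open _≈_

≈-refl : ∀ {t} → t ≈ t
≈-refl = rooted ≃-refl refl

≈-sym : ∀ {s t} → s ≈ t → t ≈ s
≈-sym (rooted φ p) = rooted (≃-sym φ) (from-≡ φ p)

≈-trans : ∀ {s t u} → s ≈ t → t ≈ u → s ≈ u
≈-trans (rooted φ p) (rooted ψ q) = rooted (≃-trans φ ψ) (trans (cong (to ψ) p) q)

◁-cong : ∀ {s s′ t t′} → s ≈ s′ → t ≈ t′ → s ◁ t ≈ s′ ◁ t′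
◁-cong (rooted φ p) (rooted ψ q) = rooted (record
  { to      = λ { (inl x) → inl (to φ x) ; (inr x) → inr (to ψ x) }
  ; from    = λ { (inl x) → inl (from φ x) ; (inr x) → inr (from ψ x) }
  ; to-from = λ { (inl x) → cong inl (to-from φ x) ; (inr x) → cong inr (to-from ψ x) }
  ; from-to = λ { (inl x) → cong inl (from-to φ x) ; (inr x) → cong inr (from-to ψ x) }
  ; pres    = λ { (left e) → left (pres φ e) ; (right e) → right (pres ψ e)
                ; (up refl refl) → up p q ; (down refl refl) → down p q }
  ; pres⁻   = λ { (left e) → left (pres⁻ φ e) ; (right e) → right (pres⁻ ψ e)
                ; (up refl refl) → up (from-≡ φ p) (from-≡ ψ q)
                ; (down refl refl) → down (from-≡ φ p) (from-≡ ψ q) } })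
  (cong inr q)

module _ {s t u : Tree} where

  exchange : V (s ◁ t ◁ u) → V (t ◁ s ◁ u)
  exchange (inl x)       = inr (inl x)
  exchange (inr (inl x)) = inl x
  exchange (inr (inr x)) = inr (inr x)

  exchange-E : ∀ {x y} → E x y → E (exchange x) (exchange y)
  exchange-E (left e)              = right (left e)
  exchange-E (right (left e))      = left e
  exchange-E (right (right e))     = right (right e)
  exchange-E (right (up p q))      = up p (cong inr q)
  exchange-E (right (down p q))    = down p (cong inr q)
  exchange-E (up p refl)           = right (up p refl)
  exchange-E (down p refl)         = right (down p refl)

exchange-involutive : ∀ {s t u} (x : V (s ◁ t ◁ u)) → exchange (exchange x) ≡ x
exchange-involutive (inl x)       = refl
exchange-involutive (inr (inl x)) = refl
exchange-involutive (inr (inr x)) = refl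

-- Both sides keep the root of `u`, so the children along the spine behave as a multiset.
◁-exchange : ∀ {s t u} → s ◁ t ◁ u ≈ t ◁ s ◁ u
◁-exchange = rooted (record
  { to = exchange ; from = exchange
  ; to-from = exchange-involutive ; from-to = exchange-involutive
  ; pres = exchange-E ; pres⁻ = exchange-E }) refl

flip : ∀ {s t} → V (s ◁ t) → V (t ◁ s)
flip (inl x) = inr x
flip (inr x) = inl x

flip-E : ∀ {s t} {x y : V (s ◁ t)} → E x y → E (flip x) (flip y)
flip-E (left e)   = right e
flip-E (right e)  = left e
flip-E (up p q)   = down q p
flip-E (down p q) = up q p

flip-involutive : ∀ {s t} (x : V (s ◁ t)) → flip (flip x) ≡ x
flip-involutive (inl x) = refl
flip-involutive (inr x) = refl

-- Moves the root across the edge between `s` and `t`; later changes of root are built from this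
-- move.
◁-flip : ∀ {s t} → s ◁ t ~ t ◁ s
◁-flip = record
  { to = flip ; from = flip ; to-from = flip-involutive ; from-to = flip-involutive
  ; pres = flip-E ; pres⁻ = flip-E }

-- Uniqueness of the decomposition into branches.

-- Every edge leaving a branch goes through the root, so a rooted isomorphism
-- that matches two children matches their whole branches.
module _ {s u c v : Tree} where

  inl-stays : (φ : s ◁ u ~ c ◁ v) → to φ (inl (root s)) ≡ inl (root c) →
              to φ (inr (root u)) ≡ inr (root v) → ∀ x → ∃ λ y → to φ (inl x) ≡ inl y
  inl-stays φ p q = connected (λ x → ∃ λ y → to φ (inl x) ≡ inl y) (root c , p) next
    where
    next : ∀ {x y} → E x y → (∃ λ z → to φ (inl x) ≡ inl z) → ∃ λ z → to φ (inl y) ≡ inl z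
    next {x} {y} e (z , eq) with to φ (inl y) in eq′ | pres φ (left {t = u} e)
    ... | inl z′ | _ = z′ , refl
    ... | inr z′ | e′ with subst (λ w → E w (inr z′)) eq e′
    -- An edge leaving `c` ends at the root of `v`, which is already the image of the root of `u`.
    ...   | up _ refl with to-injective φ (trans eq′ (≡-sym q))
    ...     | ()

-- A vertex of `u` landing in `c` would be carried back into `s` by `inl-stays` for the inverse.
inr-stays : ∀ {s u c v} (φ : s ◁ u ~ c ◁ v) → to φ (inl (root s)) ≡ inl (root c) →
            to φ (inr (root u)) ≡ inr (root v) → ∀ x → ∃ λ y → to φ (inr x) ≡ inr y
inr-stays φ p q x with to φ (inr x) in eq
... | inr y = y , refl
... | inl y with inl-stays (≃-sym φ) (from-≡ φ p) (from-≡ φ q) y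
...   | z , eq′ with trans (≡-sym (from-≡ φ eq)) eq′
...     | ()

module Split {s u c v : Tree} (φ : s ◁ u ~ c ◁ v)
  (p : to φ (inl (root s)) ≡ inl (root c)) (q : to φ (inr (root u)) ≡ inr (root v)) where

  split-left : s ≈ c
  split-left = rooted
    (restrict inl-↪ inl-↪ φ (inl-stays φ p q) (inl-stays (≃-sym φ) (from-≡ φ p) (from-≡ φ q)))
    (inl-injective (trans (≡-sym (proj₂ (inl-stays φ p q (root s)))) p))

  split-right : u ≈ v
  split-right = rooted
    (restrict inr-↪ inr-↪ φ (inr-stays φ p q) (inr-stays (≃-sym φ) (from-≡ φ p) (from-≡ φ q)))
    (inr-injective (trans (≡-sym (proj₂ (inr-stays φ p q (root u)))) q))

open Split

branch : ∀ t (x : V t) → (x ≡ root t) ⊎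
         ∃₂ λ d w → Σ (t ≈ d ◁ w) λ θ → ∃ λ y → to (iso θ) x ≡ inl y
branch •       pt      = inj₁ refl
branch (s ◁ t) (inl x) = inj₂ (s , t , ≈-refl , x , refl)
branch (s ◁ t) (inr x) with branch t x
... | inj₁ refl = inj₁ refl
... | inj₂ (d , w , θ , y , eq) =
  inj₂ (d , s ◁ w , ≈-trans (◁-cong ≈-refl θ) ◁-exchange , y , cong (exchange ∘ inr) eq)

-- The root of `s` goes to a neighbour of the root, hence to the root of a child: either `c`, or a
-- child `d` of `v`, which is then brought to the front and split off. The first case keeps the
-- vertex equation because `RAF-◁` needs it.
locate : ∀ {s u c v} (φ : s ◁ u ≈ c ◁ v) → (to (iso φ) (inl (root s)) ≡ inl (root c)) ⊎
         ∃ λ w → u ≈ c ◁ w × v ≈ s ◁ w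
locate {s} {u} {c} {v} (rooted φ p)
  with to φ (inl (root s)) in eq | pres φ (up {s} {u} refl refl)
... | inl x | e with subst (E (inl x)) p e
...   | up refl _ = inj₁ refl
locate {s} {u} {c} {v} (rooted φ p) | inr x | e with subst (E (inr x)) p e
...   | right e′ with branch v x
...     | inj₁ refl = ⊥-elim (E-irrefl e′)
...     | inj₂ (d , w , θ , y , eq′)
          with subst₂ E eq′ (root-≡ θ) (pres (iso θ) e′)
...         | up refl _ = inj₂ (w , split-right ψ ψₗ ψᵣ ,
                ≈-trans θ (◁-cong (≈-sym (split-left ψ ψₗ ψᵣ)) ≈-refl))
  where
  χ : c ◁ v ≈ d ◁ c ◁ w
  χ = ≈-trans (◁-cong ≈-refl θ) ◁-exchange
  ψ : s ◁ u ~ d ◁ c ◁ w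
  ψ = ≃-trans φ (iso χ)
  ψₗ : to ψ (inl (root s)) ≡ inl (root d)
  ψₗ = trans (cong (to (iso χ)) eq) (cong (exchange ∘ inr) eq′)
  ψᵣ : to ψ (inr (root u)) ≡ inr (inr (root w))
  ψᵣ = trans (cong (to (iso χ)) p) (root-≡ χ)

◁-unique : ∀ {s u c v} → s ◁ u ≈ c ◁ v → (s ≈ c × u ≈ v) ⊎ ∃ λ w → u ≈ c ◁ w × v ≈ s ◁ w
◁-unique φ with locate φ
... | inj₁ p = inj₁ (split-left (iso φ) p (root-≡ φ) , split-right (iso φ) p (root-≡ φ))
... | inj₂ r = inj₂ r

-- Counting vertices.

V↔Fin : ∀ t → Fin (size t) ↔ V t
V↔Fin •       = mk↔ₛ′ (λ _ → pt) (λ _ → zero) (λ { pt → refl }) (λ { zero → refl })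
V↔Fin (s ◁ t) = V-⊎ ↔-∘ ((V↔Fin s ⊎-↔ V↔Fin t) ↔-∘ +↔⊎)
  where
  V-⊎ : (V s ⊎ V t) ↔ V (s ◁ t)
  V-⊎ = mk↔ₛ′ (λ { (inj₁ x) → inl x ; (inj₂ x) → inr x })
              (λ { (inl x) → inj₁ x ; (inr x) → inj₂ x })
              (λ { (inl x) → refl ; (inr x) → refl })
              (λ { (inj₁ x) → refl ; (inj₂ x) → refl })

≃⇒↔ : ∀ {A B : Set} {R : A → A → Set} {S : B → B → Set} → R ≃ S → A ↔ B
≃⇒↔ φ = mk↔ₛ′ (to φ) (from φ) (to-from φ) (from-to φ)

size-unique : ∀ {n} {R : Fin n → Fin n → Set} {t} → R ≃ E {t} → n ≡ size t
size-unique {t = t} φ = ↔⇒≡ (↔-sym (V↔Fin t) ↔-∘ ≃⇒↔ φ)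

size-resp-≈ : ∀ {s t} → s ≈ t → size s ≡ size t
size-resp-≈ {s} {t} θ = ↔⇒≡ (↔-sym (V↔Fin t) ↔-∘ (≃⇒↔ (iso θ) ↔-∘ V↔Fin s))

size-pos : ∀ t → 1 ≤ size t
size-pos •       = ≤-refl
size-pos (s ◁ t) = ≤-trans (size-pos s) (m≤m+n (size s) (size t))

2≤size-◁ : ∀ s t → 2 ≤ size (s ◁ t)
2≤size-◁ s t = +-mono-≤ (size-pos s) (size-pos t)

size≡1⇒• : ∀ t → size t ≡ 1 → t ≡ •
size≡1⇒• •       _  = refl
size≡1⇒• (s ◁ t) eq = ⊥-elim (<-irrefl (≡-sym eq) (2≤size-◁ s t))

•≉◁ : ∀ {s t} → ¬ • ≈ s ◁ t
•≉◁ {s} {t} θ = <-irrefl (size-resp-≈ θ) (2≤size-◁ s t)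

child-< : ∀ {t d w} → t ≈ d ◁ w → size d < size t
child-< {d = d} {w} θ = subst (size d <_) (≡-sym (size-resp-≈ θ)) (m<m+n (size d) (size-pos w))

-- Trees without rooted automorphisms.

RAF : Tree → Set
RAF t = ∀ (φ : t ≈ t) x → to (iso φ) x ≡ x

AF⇒RAF : ∀ {t} → AF (E {t}) → RAF t
AF⇒RAF af φ = af (iso φ)

RAF-resp-≈ : ∀ {s t} → s ≈ t → RAF s → RAF t
RAF-resp-≈ θ raf φ x = trans (≡-sym (to-from (iso θ) _))
  (trans (cong (λ z → to (iso θ) (from (iso θ) (to (iso φ) z))) (≡-sym (to-from (iso θ) x)))
  (trans (cong (to (iso θ)) (raf (≈-trans θ (≈-trans φ (≈-sym θ))) (from (iso θ) x)))
         (to-from (iso θ) x)))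

RAF-• : RAF •
RAF-• φ pt with to (iso φ) pt
... | pt = refl

module _ {s t : Tree} where

  RAF-left : RAF (s ◁ t) → RAF s
  RAF-left raf φ x = inl-injective (raf (◁-cong φ ≈-refl) (inl x))

  RAF-right : RAF (s ◁ t) → RAF t
  RAF-right raf φ x = inr-injective (raf (◁-cong ≈-refl φ) (inr x))

  -- Exchanging two isomorphic siblings would move the root of `s`.
  RAF-distinct : RAF (s ◁ t) → ∀ {w} → ¬ t ≈ s ◁ w
  RAF-distinct raf θ
    with raf (≈-trans (◁-cong ≈-refl θ) (≈-trans ◁-exchange (◁-cong ≈-refl (≈-sym θ))))
             (inl (root s))
  ... | ()

  -- By `locate` and `distinct` the root of `s` is fixed, so the automorphism splits into one of `s`
  -- and one of `t`.
  RAF-◁ : RAF s → RAF t → (∀ {w} → ¬ t ≈ s ◁ w) → RAF (s ◁ t)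
  RAF-◁ rs rt distinct φ x with locate φ
  ... | inj₂ (w , _ , θ) = ⊥-elim (distinct θ)
  ... | inj₁ p with x
  ...   | inl y = trans (proj₂ (inl-stays (iso φ) p (root-≡ φ) y))
                        (cong inl (rs (split-left (iso φ) p (root-≡ φ)) y))
  ...   | inr y = trans (proj₂ (inr-stays (iso φ) p (root-≡ φ) y))
                        (cong inr (rt (split-right (iso φ) p (root-≡ φ)) y))

RAF-stem : ∀ {t} → RAF t → RAF (t ◁ •)
RAF-stem raf = RAF-◁ raf RAF-• •≉◁

AF-halves : ∀ {s t} → AF (E {s ◁ t}) → ¬ s ≈ t
AF-halves {s} af θ with af (≃-trans ◁-flip (iso (◁-cong (≈-sym θ) θ))) (inl (root s))
... | ()

-- Centroids and unrooted automorphisms.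

-- The root moves to `p` one edge at a time, and the branch `c` pointing back swallows everything
-- left behind, in particular `u`. `k` only bounds the recursion.
reroot : ∀ k s u (p : V s) → size s ≤ k →
         ∃₂ λ c w → Σ (s ◁ u ~ c ◁ w) λ φ → to φ (inl p) ≡ inr (root w) × size u ≤ size c
reroot zero    s u p s≤k = ⊥-elim (<⇒≱ (size-pos s) s≤k)
reroot (suc k) s u p s≤k with branch s p
... | inj₁ refl = u , s , ◁-flip , refl , ≤-refl
... | inj₂ (d , v , θ , y , eq)
    with reroot k d (u ◁ v) y (≤-pred (≤-trans (child-< θ) s≤k))
...   | c , w , φ , eq′ , le =
  c , w , ≃-trans (≃-trans ◁-flip (iso ψ)) φ ,
  trans (cong (to φ ∘ exchange ∘ inr) eq) eq′ , ≤-trans (m≤m+n (size u) (size v)) le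
  where
  ψ : u ◁ s ≈ d ◁ u ◁ v
  ψ = ≈-trans (◁-cong ≈-refl θ) ◁-exchange

-- Applying `φ` and then moving the root to `p` is a rooted isomorphism. So the branch at `p` that
-- points back and contains `u` has a copy at the root of `t`.
off-centre : ∀ {t d u p} (φ : t ~ t) (θ : t ~ d ◁ u) → to θ (to φ (root t)) ≡ inl p →
             ∃₂ λ c w → t ≈ c ◁ w × size u ≤ size c
off-centre {d = d} {u} {p} φ θ eq with reroot (size d) d u p ≤-refl
... | c , w , ψ , eq′ , le =
  c , w , rooted (≃-trans φ (≃-trans θ ψ)) (trans (cong (to ψ) eq) eq′) , le

-- Light t says that the root is the only centroid of t: every branch is
-- smaller than the rest of the tree.
Light : Tree → Set
Light t = ∀ {c u} → t ≈ c ◁ u → size c < size u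

-- Moving the root into a branch `d` would give `size d < size u ≤ size c < size w` for two
-- splittings of the same tree.
RAF∧Light⇒AF : ∀ {t} → RAF t → Light t → AF (E {t})
RAF∧Light⇒AF {t} raf light φ with branch t (to φ (root t))
... | inj₁ p = raf (rooted φ p)
... | inj₂ (d , u , θ , y , eq) with off-centre φ (iso θ) eq
...   | c , w , η , u≤c = ⊥-elim (<-irrefl
  (trans (≡-sym (size-resp-≈ θ)) (size-resp-≈ η))
  (+-mono-< (<-≤-trans (light θ) u≤c) (≤-<-trans u≤c (light η))))

module Bicentred {C D : Tree} (|C|≡|D| : size C ≡ size D) where

  balanced : ∀ {c w} → C ◁ D ≈ c ◁ w → size c ≤ size w
  balanced θ with ◁-unique θ
  ... | inj₁ (C≈c , D≈w) =
    ≤-reflexive (trans (≡-sym (size-resp-≈ C≈c)) (trans |C|≡|D| (size-resp-≈ D≈w)))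
  ... | inj₂ (y , D≈c◁y , w≈C◁y) =
    <⇒≤ (<-trans (child-< D≈c◁y) (subst (_< _) |C|≡|D| (child-< w≈C◁y)))

  -- `X ◁ v` has more than half of the vertices, and by `balanced` no branch at the root has.
  no-heavy-branch : ∀ X v {c w} → size X ≡ size C → C ◁ D ≈ c ◁ w → ¬ size (X ◁ v) ≤ size c
  no-heavy-branch X v {c} {w} |X|≡|C| θ le = <-irrefl (size-resp-≈ θ)
    (+-mono-< C<c (subst (_< size w) |C|≡|D| (<-≤-trans C<c (balanced θ))))
    where
    C<c : size C < size c
    C<c = subst (_< size c) |X|≡|C| (<-≤-trans (m<m+n (size X) (size-pos v)) le)

  -- The root of `D` is fixed, or goes to the root of `C` and the halves are isomorphic, or goes
  -- deeper, where `off-centre` produces a branch with more than half of the vertices.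
  bicentred : RAF C → RAF D → ¬ C ≈ D → AF (E {C ◁ D})
  bicentred rC rD C≉D φ with to φ (inr (root D)) in eq
  ... | inr p with branch D p
  ...   | inj₁ refl = RAF-◁ rC rD (λ η → <-irrefl |C|≡|D| (child-< η)) (rooted φ eq)
  ...   | inj₂ (d , v , θ , y , eq′) with off-centre φ
            (iso (≈-trans (◁-cong ≈-refl θ) ◁-exchange))
            (trans (cong (λ z → exchange (to (iso (◁-cong ≈-refl θ)) z)) eq)
                   (cong (exchange ∘ inr) eq′))
  ...     | c , w , η , le = ⊥-elim (no-heavy-branch C v refl η le)
  bicentred rC rD C≉D φ | inl p with branch C p
  ...   | inj₁ refl with ◁-unique {C} {D} {D} {C} (rooted (≃-trans φ ◁-flip) (cong flip eq))
  ...     | inj₁ (C≈D , _) = ⊥-elim (C≉D C≈D)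
  ...     | inj₂ (w , D≈D◁w , _) = ⊥-elim (<-irrefl refl (child-< D≈D◁w))
  bicentred rC rD C≉D φ | inl p | inj₂ (d , v , θ , y , eq′) with off-centre φ
            (≃-trans ◁-flip (iso (≈-trans (◁-cong ≈-refl θ) ◁-exchange)))
            (trans (cong (λ z → exchange (to (iso (◁-cong ≈-refl θ)) (flip z))) eq)
                   (cong (exchange ∘ inr) eq′))
  ...     | c , w , η , le = ⊥-elim (no-heavy-branch D v (≡-sym |C|≡|D|) η le)

open Bicentred using (bicentred)

-- Smallest and largest branches.

AllChildren : (ℕ → Set) → Tree → Set
AllChildren P t = ∀ {d v} → t ≈ d ◁ v → P (size d)

AllChildren-◁ : ∀ {P : ℕ → Set} {s t} → P (size s) → AllChildren P t → AllChildren P (s ◁ t)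
AllChildren-◁ {P} ps h θ with ◁-unique θ
... | inj₁ (s≈d , _)       = subst P (size-resp-≈ s≈d) ps
... | inj₂ (w , t≈d◁w , _) = h t≈d◁w

AllChildren-• : ∀ {P : ℕ → Set} → AllChildren P •
AllChildren-• θ = ⊥-elim (•≉◁ θ)

module Extremal (_≲_ : ℕ → ℕ → Set) (≲-total : ∀ m n → m ≲ n ⊎ n ≲ m)
  (≲-trans : ∀ {m n o} → m ≲ n → n ≲ o → m ≲ o) where

  extremal-child : ∀ s t → ∃₂ λ c u → s ◁ t ≈ c ◁ u × AllChildren (size c ≲_) u
  extremal-child s • = s , • , ≈-refl , AllChildren-• {size s ≲_}
  extremal-child s (t₁ ◁ t₂) with extremal-child t₁ t₂
  ... | c , u , θ , h with ≲-total (size s) (size c)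
  ...   | inj₁ s≲c = s , t₁ ◁ t₂ , ≈-refl ,
          -- Totality supplies the reflexivity `size c ≲ size c`.
          λ η → ≲-trans s≲c (AllChildren-◁ {size c ≲_} (reduce (≲-total _ _)) h
                              (≈-trans (≈-sym θ) η))
  ...   | inj₂ c≲s = c , s ◁ u , ≈-trans (◁-cong ≈-refl θ) ◁-exchange ,
          AllChildren-◁ {size c ≲_} c≲s h

open Extremal _≤_ ≤-total ≤-trans renaming (extremal-child to min-child)
open Extremal _≥_ (λ m n → ≤-total n m) (λ p q → ≤-trans q p) renaming (extremal-child to max-child)

-- Attaching, deleting and pruning leaves.

attach : ∀ {t} → V t → Tree
attach pt              = • ◁ •
attach (inl {s} {t} x) = attach x ◁ t
attach (inr {s} {t} x) = s ◁ attach x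

size-attach : ∀ {t} (q : V t) → size (attach q) ≡ suc (size t)
size-attach pt              = refl
size-attach (inl {s} {t} x) = cong (_+ size t) (size-attach x)
size-attach (inr {s} {t} x) =
  trans (cong (size s +_) (size-attach x)) (+-suc (size s) (size t))

-- The deleted leaf is never the root.
infix 4 _↓_

_↓_ : Tree → Tree → Set
t ↓ t′ = ∃ λ q → t ≈ attach {t′} q

↓-size : ∀ {t t′} → t ↓ t′ → size t ≡ suc (size t′)
↓-size (q , θ) = trans (size-resp-≈ θ) (size-attach q)

↓-resp-≈ : ∀ {s t t′} → s ≈ t → t ↓ t′ → s ↓ t′
↓-resp-≈ θ (q , η) = q , ≈-trans θ η

↓-left : ∀ {s s′ t} → s ↓ s′ → s ◁ t ↓ s′ ◁ t
↓-left (q , θ) = inl q , ◁-cong θ ≈-refl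

↓-leaf : ∀ {t} → • ◁ t ↓ t
↓-leaf {t} = root t , attach-root t
  where
  attach-root : ∀ t → • ◁ t ≈ attach (root t)
  attach-root •       = ≈-refl
  attach-root (s ◁ t) = ≈-trans ◁-exchange (◁-cong ≈-refl (attach-root t))

-- Pruning a smallest branch first keeps it different from its siblings.
prune : ∀ k t → size t ≤ k → 2 ≤ size t → RAF t →
        ∃ λ t′ → t ↓ t′ × RAF t′ × (∀ m → AllChildren (_≤ m) t → AllChildren (_≤ m) t′)
prune zero    t       t≤0 2≤t raf = ⊥-elim (<⇒≱ (size-pos t) t≤0)
prune (suc k) •       _   2≤t raf = ⊥-elim (<-irrefl refl 2≤t)
prune (suc k) (s ◁ t) t≤k 2≤t raf with min-child s t
... | • , u , θ , min =
  u , ↓-resp-≈ θ ↓-leaf , RAF-right (RAF-resp-≈ θ raf) ,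
  λ m h η → h (≈-trans θ (≈-trans (◁-cong ≈-refl η) ◁-exchange))
... | c@(c₁ ◁ c₂) , u , θ , min
    with prune k c (≤-pred (≤-trans (child-< θ) t≤k)) (2≤size-◁ c₁ c₂)
           (RAF-left (RAF-resp-≈ θ raf))
...   | c′ , c↓c′ , rc′ , _ =
  c′ ◁ u , ↓-resp-≈ θ (↓-left c↓c′) ,
  RAF-◁ rc′ (RAF-right (RAF-resp-≈ θ raf)) (λ η → <⇒≱ c′<c (min η)) ,
  λ m h → AllChildren-◁ {_≤ m} (≤-trans (<⇒≤ c′<c) (h θ))
    (λ η → h (≈-trans θ (≈-trans (◁-cong ≈-refl η) ◁-exchange)))
  where
  c′<c : size c′ < size c
  c′<c = ≤-reflexive (≡-sym (↓-size c↓c′))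

prune-raf : ∀ t → 2 ≤ size t → RAF t → ∃ λ t′ → t ↓ t′ × RAF t′
prune-raf t 2≤t raf with prune (size t) t ≤-refl 2≤t raf
... | t′ , t↓t′ , raf′ , _ = t′ , t↓t′ , raf′

-- Stuck trees with two halves of equal size.

-- `r` ranges over all choices of root, so that any leaf of the unrooted tree may be the deleted
-- one.
Stuck : Tree → Set
Stuck t = ∀ {r r′} → t ~ r → r ↓ r′ → ¬ AF (E {r′})

Stuck-resp-~ : ∀ {s t} → s ~ t → Stuck s → Stuck t
Stuck-resp-~ θ stuck η = stuck (≃-trans θ η)

-- Doubly negated because isomorphism of trees is never decided; the arguments using it all end in a
-- contradiction.
Forces : Tree → Tree → Set
Forces D C = ∀ {D′} → D ↓ D′ → RAF D′ → ¬ ¬ C ≈ D′ ◁ •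

stem-injective : ∀ {s t} → s ◁ • ≈ t ◁ • → s ≈ t
stem-injective θ with ◁-unique θ
... | inj₁ (s≈t , _)     = s≈t
... | inj₂ (_ , •≈ , _)  = ⊥-elim (•≉◁ •≈)

stem-cong : ∀ {s t} → s ≈ t → s ◁ • ≈ t ◁ •
stem-cong θ = ◁-cong θ ≈-refl

-- Pruned once, C and D become D₀ and C₀ with C ≈ D₀ ◁ • and D ≈ C₀ ◁ •, and
-- D₀, C₀ inherit the hypotheses.
mutual-forcing : ∀ k C D → size C ≤ k → size C ≡ size D → RAF C → RAF D →
                 Forces D C → Forces C D → ¬ ¬ C ≈ D
mutual-forcing zero    C D C≤0 _ _ _ _ _ _ = <⇒≱ (size-pos C) C≤0
mutual-forcing (suc k) • D _ |C|≡|D| _ _ _ _ C≉D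
  with size≡1⇒• D (≡-sym |C|≡|D|)
... | refl = C≉D ≈-refl
mutual-forcing (suc k) C@(C₁ ◁ C₂) D C≤k |C|≡|D| rC rD D⇒C C⇒D C≉D
  with prune-raf C (2≤size-◁ C₁ C₂) rC
     | prune-raf D (subst (2 ≤_) |C|≡|D| (2≤size-◁ C₁ C₂)) rD
... | C₀ , C↓C₀ , rC₀ | D₀ , D↓D₀ , rD₀ =
  D⇒C D↓D₀ rD₀ λ C≈D₀• → C⇒D C↓C₀ rC₀ λ D≈C₀• →
  mutual-forcing k D₀ C₀
    (≤-pred (subst (_≤ suc k) (trans |C|≡|D| (↓-size D↓D₀)) C≤k))
    (suc-injective (trans (≡-sym (↓-size D↓D₀)) (trans (≡-sym |C|≡|D|) (↓-size C↓C₀))))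
    rD₀ rC₀
    -- A pruning of `C₀` is one of `D ≈ C₀ ◁ •` below the stem. Cancelling a stem in what it forces
    -- on `C ≈ D₀ ◁ •` gives the condition on `D₀`.
    (λ C₀↓ r n → D⇒C (↓-resp-≈ D≈C₀• (↓-left C₀↓)) (RAF-stem r)
      λ η → n (stem-injective (≈-trans (≈-sym C≈D₀•) η)))
    (λ D₀↓ r n → C⇒D (↓-resp-≈ C≈D₀• (↓-left D₀↓)) (RAF-stem r)
      λ η → n (stem-injective (≈-trans (≈-sym D≈C₀•) η)))
    (λ D₀≈C₀ → C≉D (≈-trans C≈D₀• (≈-trans (stem-cong D₀≈C₀) (≈-sym D≈C₀•))))

Light-◁ : ∀ {s u} → size s < size u →
          (∀ {d y} → u ≈ d ◁ y → size d < size s + size y) → Light (s ◁ u)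
Light-◁ s<u h θ with ◁-unique θ
... | inj₁ (s≈d , u≈v) = subst₂ _<_ (size-resp-≈ s≈d) (size-resp-≈ u≈v) s<u
... | inj₂ (y , u≈d◁y , v≈s◁y) = subst (_ <_) (≡-sym (size-resp-≈ v≈s◁y)) (h u≈d◁y)

-- With `D` pruned to `D′`, the root of `C` is the only centroid. A rooted symmetry needs a child of
-- `C` isomorphic to `D′`, and sizes then leave a single vertex beside it.
bicentral-forces : ∀ {C D} → size C ≡ size D → Stuck (C ◁ D) → RAF C → Forces D C
bicentral-forces {C} {D} |C|≡|D| stuck rC {D′} D↓D′ rD′ C≉ =
  stuck ◁-flip (↓-left D↓D′) (RAF∧Light⇒AF (RAF-◁ rD′ rC distinct) (Light-◁ D′<C light))
  where
  |C|≡1+|D′| : size C ≡ suc (size D′)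
  |C|≡1+|D′| = trans |C|≡|D| (↓-size D↓D′)
  D′<C : size D′ < size C
  D′<C = ≤-reflexive (≡-sym |C|≡1+|D′|)
  distinct : ∀ {w} → ¬ C ≈ D′ ◁ w
  distinct {w} η with size≡1⇒• w (+-cancelˡ-≡ (size D′) (size w) 1
                        (trans (≡-sym (size-resp-≈ η)) (trans |C|≡1+|D′| (+-comm 1 (size D′)))))
  ... | refl = C≉ η
  light : ∀ {d y} → C ≈ d ◁ y → size d < size D′ + size y
  light {y = y} η = ≤-<-trans (≤-pred (subst (_ ≤_) |C|≡1+|D′| (child-< η)))
                      (m<m+n (size D′) (size-pos y))

bicentral-stuck : ∀ {C D} → size C ≡ size D → AF (E {C ◁ D}) → ¬ Stuck (C ◁ D)
bicentral-stuck {C} {D} |C|≡|D| af stuck =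
  mutual-forcing (size C) C D ≤-refl |C|≡|D| rC rD
    (bicentral-forces |C|≡|D| stuck rC)
    (bicentral-forces (≡-sym |C|≡|D|) (Stuck-resp-~ ◁-flip stuck) rD)
    (AF-halves af)
  where
  rC : RAF C
  rC = RAF-left (AF⇒RAF af)
  rD : RAF D
  rD = RAF-right (AF⇒RAF af)

-- The rest exceeds the largest branch by one vertex.

-- The deletion leaves two halves of equal size, so by `bicentred` only an isomorphism between them
-- can spoil asymmetry.
lopsided-stuck : ∀ {B R R′} → Stuck (B ◁ R) → RAF B → R ↓ R′ → RAF R′ →
                 size B ≡ size R′ → ¬ ¬ B ≈ R′
lopsided-stuck stuck rB R↓R′ rR′ |B|≡|R′| B≉R′ =
  stuck ◁-flip (↓-left R↓R′) (bicentred (≡-sym |B|≡|R′|) rR′ rB (B≉R′ ∘ ≈-sym))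

stem₂ : Tree
stem₂ = • ◁ •

stem₃ : Tree
stem₃ = stem₂ ◁ •

-- The centre is the root of the last `stem₃`, whose other two vertices form the leg of length 2;
-- the first `stem₃` is the leg of length 3.
spider₁₂₃ : Tree
spider₁₂₃ = stem₃ ◁ • ◁ stem₃

RAF-stem₂ : RAF stem₂
RAF-stem₂ = RAF-stem RAF-•

size≡2⇒stem₂ : ∀ t → size t ≡ 2 → t ≡ stem₂
size≡2⇒stem₂ (s ◁ t) eq with size≡1⇒• s (≤-antisym (≤-pred s<2) (size-pos s))
  where
  s<2 : size s < 2
  s<2 = subst (size s <_) eq (child-< {s ◁ t} ≈-refl)
... | refl with size≡1⇒• t (suc-injective eq)
...   | refl = refl

-- The only other shape, a root with two leaf children, has a swap.
RAF∧size≡3⇒stem₃ : ∀ t → RAF t → size t ≡ 3 → t ≡ stem₃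
RAF∧size≡3⇒stem₃ (• ◁ t) raf eq with size≡2⇒stem₂ t (suc-injective eq)
... | refl = ⊥-elim (RAF-distinct raf ≈-refl)
RAF∧size≡3⇒stem₃ (s@(s₁ ◁ s₂) ◁ t) raf eq with size≡1⇒• t
    (≤-antisym (+-cancelˡ-≤ 2 (size t) 1
                 (≤-trans (+-monoˡ-≤ (size t) (2≤size-◁ s₁ s₂)) (≤-reflexive eq)))
               (size-pos t))
... | refl with size≡2⇒stem₂ s (suc-injective (trans (+-comm 1 (size s)) eq))
...   | refl = refl

module NearlyBicentral {B B′ c w : Tree} (B↓B′ : B ↓ B′)
  (|cw| : size (c ◁ w) ≡ suc (size B)) (2≤w : 2 ≤ size w) where

  |cw|≡2+|B′| : size c + size w ≡ 2 + size B′
  |cw|≡2+|B′| = trans |cw| (cong suc (↓-size B↓B′))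

  c≤B′ : size c ≤ size B′
  c≤B′ = +-cancelˡ-≤ 2 (size c) (size B′)
    (≤-trans (+-monoˡ-≤ (size c) 2≤w)
      (≤-reflexive (trans (+-comm (size w) (size c)) |cw|≡2+|B′|)))

  w≤1+B′ : size w ≤ suc (size B′)
  w≤1+B′ = ≤-pred (≤-trans (+-monoˡ-≤ (size w) (size-pos c)) (≤-reflexive |cw|≡2+|B′|))

  -- The rest exceeds `B′` by two vertices, and `c` and all children of `w` have size at most
  -- `size B′`.
  pruned-Light : Light (B′ ◁ c ◁ w)
  pruned-Light = Light-◁
    (subst (size B′ <_) (≡-sym |cw|≡2+|B′|) (m≤n+m (suc (size B′)) 1))
    (λ {d} {y} η → ≤-<-trans
      (AllChildren-◁ {_≤ size B′} c≤B′ (λ ζ → ≤-pred (≤-trans (child-< ζ) w≤1+B′)) η)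
      (m<m+n (size B′) (size-pos y)))

  pruned-AF : RAF B′ → RAF (c ◁ w) → (∀ {x} → ¬ c ◁ w ≈ B′ ◁ x) → AF (E {B′ ◁ c ◁ w})
  pruned-AF rB′ rcw distinct = RAF∧Light⇒AF (RAF-◁ rB′ rcw distinct) pruned-Light

-- The centre has only the branches `B` and `c`. Pruning one and counting the centre with it leaves
-- equal halves, so `lopsided-stuck` gives `Forces` both ways.
near-stem : ∀ {B c} → size c ≡ size B → RAF (B ◁ c ◁ •) → ¬ Stuck (B ◁ c ◁ •)
near-stem {B} {c} |c|≡|B| raf stuck =
  mutual-forcing (size c) c B ≤-refl |c|≡|B| rc rB
    (λ B↓B′ rB′ → lopsided-stuck (Stuck-resp-~ (iso ◁-exchange) stuck) rc (↓-left B↓B′)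
      (RAF-stem rB′) (trans |c|≡|B| (size-stem B↓B′)))
    (λ c↓c′ rc′ → lopsided-stuck stuck rB (↓-left c↓c′)
      (RAF-stem rc′) (trans (≡-sym |c|≡|B|) (size-stem c↓c′)))
    (λ c≈B → RAF-distinct raf (stem-cong c≈B))
  where
  rB : RAF B
  rB = RAF-left raf
  rc : RAF c
  rc = RAF-left (RAF-right raf)
  size-stem : ∀ {t t′} → t ↓ t′ → size t ≡ size (t′ ◁ •)
  size-stem {t′ = t′} t↓t′ = trans (↓-size t↓t′) (+-comm 1 (size t′))

-- `B` can be pruned without creating a twin of `B′`: if `c` were one, `w₁` would be a single
-- vertex, smaller than the smallest child `c`; if a child of `w₁ ◁ w₂` were one, the rest would be
-- too large.
near-thick : ∀ {B c w₁ w₂} → 2 ≤ size c → size (c ◁ w₁ ◁ w₂) ≡ suc (size B) →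
             AllChildren (size c ≤_) (w₁ ◁ w₂) → RAF (B ◁ c ◁ w₁ ◁ w₂) →
             ¬ Stuck (B ◁ c ◁ w₁ ◁ w₂)
near-thick {B} {c} {w₁} {w₂} 2≤c |cw| min raf stuck
  with prune-raf B 2≤B (RAF-left raf)
  where
  2≤B : 2 ≤ size B
  2≤B = ≤-pred (subst (3 ≤_) |cw|
          (+-mono-≤ (size-pos c) (2≤size-◁ w₁ w₂)))
... | B′ , B↓B′ , rB′ = stuck ≃-refl (↓-left B↓B′) (pruned-AF rB′ (RAF-right raf) distinct)
  where
  open NearlyBicentral {c = c} {w₁ ◁ w₂} B↓B′ |cw| (2≤size-◁ w₁ w₂)
  distinct : ∀ {x} → ¬ c ◁ w₁ ◁ w₂ ≈ B′ ◁ x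
  distinct η with ◁-unique η
  ... | inj₁ (c≈B′ , _) = <⇒≱ 2≤c (≤-trans (min ≈-refl) (≤-pred w₁<2))
    where
    |w|≡2 : size (w₁ ◁ w₂) ≡ 2
    |w|≡2 = +-cancelˡ-≡ (size c) _ 2 (trans |cw|≡2+|B′|
              (trans (+-comm 2 (size B′)) (cong (_+ 2) (≡-sym (size-resp-≈ c≈B′)))))
    w₁<2 : size w₁ < 2
    w₁<2 = subst (size w₁ <_) |w|≡2 (child-< {w₁ ◁ w₂} ≈-refl)
  ... | inj₂ (y , w≈B′◁y , _) =
    <-irrefl refl (subst (3 + size B′ ≤_) |cw|≡2+|B′| (+-mono-≤ 2≤c (child-< w≈B′◁y)))

near-leaf : ∀ n {B w} → size B ≡ 4 + n → size w ≡ size B → RAF (B ◁ • ◁ w) →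
            ¬ Stuck (B ◁ • ◁ w)
-- The contradiction is in root degrees: `B ≈ w ≈ P ◁ •` has one child at the root, `P′ ◁ stem₂` has
-- two. Four vertices in `B` keep `P′` bigger than the leaf beside it, so that this last tree is
-- asymmetric.
near-leaf n {B} {w} |B| |w|≡|B| raf stuck
  with prune-raf B (subst (2 ≤_) (≡-sym |B|) (s≤s (s≤s z≤n))) (RAF-left raf)
... | P , B↓P , rP with prune-raf P (subst (2 ≤_) (≡-sym |P|) (s≤s (s≤s z≤n))) rP
  where
  |P| : size P ≡ 3 + n
  |P| = suc-injective (trans (≡-sym (↓-size B↓P)) |B|)
... | P′ , P↓P′ , rP′ =
  lopsided-stuck stuck rB ↓-leaf rw (≡-sym |w|≡|B|) λ B≈w →
  w≉P• λ w≈P• →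
  lopsided-stuck stuck rB
    (↓-resp-≈ (≈-trans (◁-cong ≈-refl w≈P•) ◁-exchange) (↓-left P↓P′))
    (RAF-◁ rP′ RAF-stem₂ stem₂-distinct) |B|≡
    λ B≈ → absurd (≈-trans (≈-sym w≈P•) (≈-trans (≈-sym B≈w) B≈))
  where
  rB : RAF B
  rB = RAF-left raf
  rw : RAF w
  rw = RAF-right (RAF-right raf)
  |P′| : size P′ ≡ 2 + n
  |P′| = suc-injective (trans (≡-sym (↓-size P↓P′))
           (suc-injective (trans (≡-sym (↓-size B↓P)) |B|)))
  |B|≡ : size B ≡ size (P′ ◁ stem₂)
  |B|≡ = trans (↓-size B↓P) (trans (cong suc (↓-size P↓P′)) (+-comm 2 (size P′)))
  •≉P′ : ¬ • ≈ P′
  •≉P′ η with trans (size-resp-≈ η) |P′|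
  ... | ()
  •≉P : ¬ • ≈ P
  •≉P η with trans (size-resp-≈ η) (trans (↓-size P↓P′) (cong suc |P′|))
  ... | ()
  stem₂-distinct : ∀ {x} → ¬ stem₂ ≈ P′ ◁ x
  stem₂-distinct η with ◁-unique η
  ... | inj₁ (•≈P′ , _)   = •≉P′ •≈P′
  ... | inj₂ (_ , •≈ , _) = •≉◁ •≈
  absurd : ¬ P ◁ • ≈ P′ ◁ stem₂
  absurd η with ◁-unique η
  ... | inj₁ (_ , •≈)     = •≉◁ •≈
  ... | inj₂ (_ , •≈ , _) = •≉◁ •≈
  w≉P• : ¬ ¬ w ≈ P ◁ •
  w≉P• w≉ = stuck ≃-refl (↓-left B↓P) (pruned-AF rP (RAF-right raf) distinct)
    where
    open NearlyBicentral {c = •} {w} B↓P (cong suc |w|≡|B|)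
           (subst (2 ≤_) (≡-sym (trans |w|≡|B| |B|)) (s≤s (s≤s z≤n)))
    distinct : ∀ {x} → ¬ • ◁ w ≈ P ◁ x
    distinct η with ◁-unique η
    ... | inj₁ (•≈P , _) = •≉P •≈P
    ... | inj₂ (y , w≈P◁y , _) with size≡1⇒• y (+-cancelˡ-≡ (size P) (size y) 1
            (trans (≡-sym (size-resp-≈ w≈P◁y))
              (trans |w|≡|B| (trans (↓-size B↓P) (+-comm 1 (size P))))))
    ...   | refl = w≉ w≈P◁y

near : ∀ {B c w} → size (c ◁ w) ≡ suc (size B) → AllChildren (size c ≤_) w →
       RAF (B ◁ c ◁ w) → Stuck (B ◁ c ◁ w) → B ◁ c ◁ w ≡ spider₁₂₃
near {c = c} {•} |cw| min raf stuck =
  ⊥-elim (near-stem (suc-injective (trans (+-comm 1 (size c)) |cw|)) raf stuck)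
near {c = c₁ ◁ c₂} {w₁ ◁ w₂} |cw| min raf stuck =
  ⊥-elim (near-thick (2≤size-◁ c₁ c₂) |cw| min raf stuck)
near {B} {•} {w@(w₁ ◁ w₂)} |cw| min raf stuck = by-size (size B) refl
  where
  |w|≡|B| : size w ≡ size B
  |w|≡|B| = suc-injective |cw|
  by-size : ∀ n → size B ≡ n → B ◁ • ◁ w ≡ spider₁₂₃
  by-size 0 eq = ⊥-elim (<⇒≱ (size-pos B) (≤-reflexive eq))
  by-size 1 eq = ⊥-elim (<-irrefl (≡-sym (trans |w|≡|B| eq)) (2≤size-◁ w₁ w₂))
  -- Here `w` would be `stem₂`, giving the centre two leaf children.
  by-size 2 eq = ⊥-elim (RAF-distinct (RAF-right raf)
    (subst (w ≈_) (size≡2⇒stem₂ w (trans |w|≡|B| eq)) ≈-refl))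
  by-size 3 eq = cong₂ (λ s t → s ◁ • ◁ t)
    (RAF∧size≡3⇒stem₃ B (RAF-left raf) eq)
    (RAF∧size≡3⇒stem₃ w (RAF-right (RAF-right raf)) (trans |w|≡|B| eq))
  by-size (suc (suc (suc (suc n)))) eq = ⊥-elim (near-leaf n eq |w|≡|B| raf stuck)

-- Choice of a centroid and the case split.

-- Re-rooting at the largest child shrinks the largest branch as long as that
-- branch is bigger than the rest.
Centroid : Tree → Set
Centroid t = ∃₂ λ B R → t ~ B ◁ R × AllChildren (_≤ size B) (B ◁ R) × size B ≤ size R

centroid : ∀ k {t} B R → size B ≤ k → t ~ B ◁ R → AllChildren (_≤ size B) R → Centroid t
centroid zero    B R B≤0 _ _ = ⊥-elim (<⇒≱ (size-pos B) B≤0)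
centroid (suc k) B R B≤k θ max with size B ≤? size R
... | yes B≤R = B , R , θ , AllChildren-◁ {_≤ size B} ≤-refl max , B≤R
... | no  B≰R with max-child R B
...   | c , u , η , max′ = centroid k c u
        (≤-pred (≤-trans (AllChildren-◁ {_< size B} (≰⇒> B≰R) child-< η) B≤k))
        (≃-trans θ (≃-trans ◁-flip (iso η))) max′

stuck⇒spider₁₂₃ : ∀ t → 2 ≤ size t → AF (E {t}) → Stuck t → t ~ spider₁₂₃
stuck⇒spider₁₂₃ • 2≤t _ _ = ⊥-elim (<-irrefl refl 2≤t)
stuck⇒spider₁₂₃ (s ◁ t) _ af stuck with max-child s t
... | c , u , η , max with centroid (size c) c u ≤-refl (iso η) max
... | B , R , θ , max′ , B≤R with <-cmp (size R) (suc (size B))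
... | tri< R<1+B _ _ = ⊥-elim (bicentral-stuck (≤-antisym B≤R (≤-pred R<1+B))
                         (AF-resp-≃ θ af) (Stuck-resp-~ θ stuck))
... | tri> _ _ 1+B<R = ⊥-elim (far
    (prune _ (B ◁ R) ≤-refl (2≤size-◁ B R) (AF⇒RAF (AF-resp-≃ θ af))))
  where
  far : ¬ ∃ λ t′ → B ◁ R ↓ t′ × RAF t′ ×
          (∀ m → AllChildren (_≤ m) (B ◁ R) → AllChildren (_≤ m) t′)
  far (t′ , BR↓t′ , raf′ , max-kept) = stuck θ BR↓t′ (RAF∧Light⇒AF raf′ light)
    where
    light : Light t′
    -- Otherwise `c` and `u` both have size at most `size B`, but `t′` has `size B + size R`
    -- vertices less one, more than twice `size B`.
    light {c} {u} ζ = ≰⇒> λ u≤c → <-irrefl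
      (trans (+-suc (size c) (size u))
        (trans (cong suc (≡-sym (size-resp-≈ ζ))) (≡-sym (↓-size BR↓t′))))
      (+-mono-≤-< (max-kept (size B) max′ ζ)
        (≤-<-trans (s≤s (≤-trans u≤c (max-kept (size B) max′ ζ))) 1+B<R))
... | tri≈ _ |R|≡1+|B| _ with R
...   | • = ⊥-elim (<⇒≱ (size-pos B) (≤-reflexive (≡-sym (suc-injective |R|≡1+|B|))))
...   | r₁ ◁ r₂ with min-child r₁ r₂
...     | e , w , ζ , min = subst (s ◁ t ~_)
            (near (trans (≡-sym (size-resp-≈ ζ)) |R|≡1+|B|) min
              (AF⇒RAF (AF-resp-≃ ξ af)) (Stuck-resp-~ ξ stuck)) ξ
  where
  ξ : s ◁ t ~ B ◁ e ◁ w
  ξ = ≃-trans θ (iso (◁-cong ≈-refl ζ))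

-- Attaching as the addition of a leaf to a graph.

module AttachIso where

  private
    inl-just : ∀ {s t} → Maybe (V s) → Maybe (V (s ◁ t))
    inl-just = Maybe.map inl

    inr-just : ∀ {s t} → Maybe (V t) → Maybe (V (s ◁ t))
    inr-just = Maybe.map inr

    inl-Add : ∀ {s t q x y} → Add (E {s}) q x y → Add (E {s ◁ t}) (inl q) (inl-just x) (inl-just y)
    inl-Add (old e) = old (left e)
    inl-Add fwd     = fwd
    inl-Add bwd     = bwd

    inr-Add : ∀ {s t q x y} → Add (E {t}) q x y → Add (E {s ◁ t}) (inr q) (inr-just x) (inr-just y)
    inr-Add (old e) = old (right e)
    inr-Add fwd     = fwd
    inr-Add bwd     = bwd

  -- The root is tracked so that the induction can carry over the edge joining `s` to `t`.
  attach-≃ : ∀ {t} (q : V t) →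
             Σ (Add (E {t}) q ≃ E {attach q}) λ φ → to φ (just (root t)) ≡ root (attach q)
  attach-≃ pt = record
    { to      = λ { (just pt) → inr pt ; nothing → inl pt }
    ; from    = λ { (inr pt) → just pt ; (inl pt) → nothing }
    ; to-from = λ { (inr pt) → refl ; (inl pt) → refl }
    ; from-to = λ { (just pt) → refl ; nothing → refl }
    ; pres    = λ { fwd → down refl refl ; bwd → up refl refl }
    ; pres⁻   = λ { (up refl refl) → bwd ; (down refl refl) → fwd } } , refl
  attach-≃ (inl {s} {t} q) with attach-≃ q
  ... | φ , p = record
    { to      = f
    ; from    = g
    ; to-from = λ { (inl z) → trans (f-inl-just (from φ z)) (cong inl (to-from φ z))
                  ; (inr y) → refl }
    ; from-to = λ { (just (inl y)) → cong inl-just (from-to φ (just y))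
                  ; (just (inr y)) → refl
                  ; nothing → cong inl-just (from-to φ nothing) }
    ; pres    = λ { (old (left e)) → left (pres φ (old e))
                  ; (old (right e)) → right e
                  ; (old (up refl refl)) → up p refl
                  ; (old (down refl refl)) → down p refl
                  ; fwd → left (pres φ fwd)
                  ; bwd → left (pres φ bwd) }
    ; pres⁻   = λ { (left e) → inl-Add (pres⁻ φ e)
                  ; (right e) → old (right e)
                  ; (up refl refl) → subst (λ z → Add E (inl q) z (just (inr (root t))))
                      (cong inl-just (≡-sym (from-≡ φ p))) (old (up refl refl))
                  ; (down refl refl) → subst (λ z → Add E (inl q) (just (inr (root t))) z)
                      (cong inl-just (≡-sym (from-≡ φ p))) (old (down refl refl)) } } , refl
    where
    f : Maybe (V (s ◁ t)) → V (attach q ◁ t)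
    f (just (inl y)) = inl (to φ (just y))
    f (just (inr y)) = inr y
    f nothing        = inl (to φ nothing)
    g : V (attach q ◁ t) → Maybe (V (s ◁ t))
    g (inl z) = inl-just (from φ z)
    g (inr y) = just (inr y)
    f-inl-just : ∀ m → f (inl-just m) ≡ inl (to φ m)
    f-inl-just (just x) = refl
    f-inl-just nothing  = refl
  attach-≃ (inr {s} {t} q) with attach-≃ q
  ... | φ , p = record
    { to      = f
    ; from    = g
    ; to-from = λ { (inr z) → trans (f-inr-just (from φ z)) (cong inr (to-from φ z))
                  ; (inl y) → refl }
    ; from-to = λ { (just (inr y)) → cong inr-just (from-to φ (just y))
                  ; (just (inl y)) → refl
                  ; nothing → cong inr-just (from-to φ nothing) }
    ; pres    = λ { (old (right e)) → right (pres φ (old e))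
                  ; (old (left e)) → left e
                  ; (old (up refl refl)) → up refl p
                  ; (old (down refl refl)) → down refl p
                  ; fwd → right (pres φ fwd)
                  ; bwd → right (pres φ bwd) }
    ; pres⁻   = λ { (right e) → inr-Add (pres⁻ φ e)
                  ; (left e) → old (left e)
                  ; (up refl refl) → subst (λ z → Add E (inr q) (just (inl (root s))) z)
                      (cong inr-just (≡-sym (from-≡ φ p))) (old (up refl refl))
                  ; (down refl refl) → subst (λ z → Add E (inr q) z (just (inl (root s))))
                      (cong inr-just (≡-sym (from-≡ φ p))) (old (down refl refl)) } } , cong inr p
    where
    f : Maybe (V (s ◁ t)) → V (s ◁ attach q)
    f (just (inl y)) = inl y
    f (just (inr y)) = inr (to φ (just y))
    f nothing        = inr (to φ nothing)
    g : V (s ◁ attach q) → Maybe (V (s ◁ t))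
    g (inl y) = just (inl y)
    g (inr z) = inr-just (from φ z)
    f-inr-just : ∀ m → f (inr-just m) ≡ inr (to φ m)
    f-inr-just (just x) = refl
    f-inr-just nothing  = refl

open AttachIso using (attach-≃)

-- Translation between graphs and relations.

≅⇒≃ : ∀ {m n} {G : Graph m} {H : Graph n} → G ≅ H → Adj G ≃ Adj H
≅⇒≃ {G = G} {H} (φ , h) = record
  { to      = Inverse.to φ
  ; from    = Inverse.from φ
  ; to-from = Inverse.strictlyInverseˡ φ
  ; from-to = Inverse.strictlyInverseʳ φ
  ; pres    = λ {x} {y} e → trans (≡-sym (h x y)) e
  ; pres⁻   = λ {x} {y} e → trans (h _ _)
      (trans (cong₂ (adj H) (Inverse.strictlyInverseˡ φ x) (Inverse.strictlyInverseˡ φ y)) e) }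

≃⇒≅ : ∀ {m n} {G : Graph m} {H : Graph n} → Adj G ≃ Adj H → G ≅ H
≃⇒≅ {G = G} φ = ≃⇒↔ φ ,
  λ u v → ⇔→≡ (mk⇔ (pres φ) (λ e → subst₂ (Adj G) (from-to φ u) (from-to φ v) (pres⁻ φ e)))

AutomorphismFree⇒AF : ∀ {n} {G : Graph n} → AutomorphismFree G → AF (Adj G)
AutomorphismFree⇒AF {G = G} free φ = free (≃⇒↔ φ) (proj₂ (≃⇒≅ {G = G} {G} φ))

AF⇒AutomorphismFree : ∀ {n} {G : Graph n} → AF (Adj G) → AutomorphismFree G
AF⇒AutomorphismFree {G = G} af φ h = af (≅⇒≃ {G = G} {G} (φ , h))

Adj-irrefl : ∀ {n} (G : Graph n) {u} → ¬ Adj G u u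
Adj-irrefl G {u} e with trans (≡-sym (irrefl G u)) e
... | ()

Adj-sym : ∀ {n} (G : Graph n) {u v} → Adj G u v → Adj G v u
Adj-sym G {u} {v} e = trans (sym G v u) e

-- Finding a leaf in a finite tree.

lookup-injective : ∀ {A : Set} {xs : List A} → Unique xs → ∀ {i j} →
                   lookup xs i ≡ lookup xs j → i ≡ j
lookup-injective (x≢ ∷ u) {zero}  {zero}  eq = refl
lookup-injective (x≢ ∷ u) {zero}  {suc j} eq = ⊥-elim (All.lookup x≢ (∈-lookup j) eq)
lookup-injective (x≢ ∷ u) {suc i} {zero}  eq = ⊥-elim (All.lookup x≢ (∈-lookup i) (≡-sym eq))
lookup-injective (x≢ ∷ u) {suc i} {suc j} eq = cong suc (lookup-injective u eq)

Unique⇒length≤ : ∀ {n} {xs : List (Fin n)} → Unique xs → length xs ≤ n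
Unique⇒length≤ u = injective⇒≤ (lookup-injective u)

Unique-prefix : ∀ {A : Set} {w : A} xs {ys} → Unique (xs ++ w ∷ ys) → Unique (w ∷ xs)
Unique-prefix []       _        = [] ∷ []
Unique-prefix (x ∷ xs) (x≢ ∷ u) with Unique-prefix xs u | All.head (All.++⁻ʳ xs x≢)
... | w≢ ∷ u′ | x≢w = ((x≢w ∘ ≡-sym) ∷ w≢) ∷ (All.++⁻ˡ xs x≢ ∷ u′)

module _ {n} (T : Graph n) where

  Linked⇒PathAdj : ∀ {x w} xs {ys} → Linked (Adj T) (x ∷ xs ++ w ∷ ys) → PathAdj T x xs w
  Linked⇒PathAdj []       (e ∷ _) = e
  Linked⇒PathAdj (y ∷ xs) (e ∷ l) = e , Linked⇒PathAdj xs l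

  -- A non-backtracking walk never returns in a forest, so it must end in a leaf.
  extend-to-leaf : Acyclic T → ∀ k a b ps → n < k + length (a ∷ b ∷ ps) →
                   Unique (a ∷ b ∷ ps) → Linked (Adj T) (a ∷ b ∷ ps) → ∃ (IsLeaf T)
  -- Without fuel the list would hold more than `n` distinct vertices.
  extend-to-leaf acyc zero    a b ps n< u l = ⊥-elim (<⇒≱ n< (Unique⇒length≤ u))
  extend-to-leaf acyc (suc k) a b ps n< u@((a≢b ∷ _) ∷ _) l@(ab ∷ _)
    with any? (λ w → (adj T a w Bool.≟ true) ×-dec ¬? (w Fin.≟ b))
  ... | no none = a , b , ab , λ w aw → decidable-stable (w Fin.≟ b) λ w≢b → none (w , aw , w≢b)
  ... | yes (w , aw , w≢b) with _∈?_ Fin._≟_ w ps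
  ...   | no w∉ps = extend-to-leaf acyc k w a (b ∷ ps)
            (subst (n <_) (≡-sym (+-suc k _)) n<)
            (((λ { refl → Adj-irrefl T aw }) ∷ w≢b ∷ ¬Any⇒All¬ ps w∉ps) ∷ u)
            (Adj-sym T aw ∷ l)
  ...   | yes w∈ps with ∈-∃++ w∈ps
  ...     | xs , ys , refl = ⊥-elim (acyc (w ∷ a ∷ b ∷ xs)
              ( Unique-prefix (a ∷ b ∷ xs) u , s≤s (s≤s (s≤s z≤n))
              , Adj-sym T aw , Linked⇒PathAdj (b ∷ xs) l ))

leaf-exists : ∀ {n} (T : Graph (2 + n)) → IsTree T → ∃ (IsLeaf T)
leaf-exists {n} T (conn , acyc) with conn zero (suc zero)
... | step {v = v} e _ = extend-to-leaf T acyc (2 + n) zero v []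
  (m<m+n (2 + n) (s≤s z≤n)) (((λ { refl → Adj-irrefl T e }) ∷ []) ∷ [] ∷ []) (e ∷ [-])

-- Deleting a leaf of a graph.

module _ {n} (T : Graph (suc n)) (v : Fin (suc n)) where

  private
    in-v : Fin n → Fin (suc n)
    in-v = punchIn v

  delete-↪ : Adj (delete T v) ↪ Adj T
  delete-↪ = record
    { emb = in-v ; injective = λ {x} {y} → punchIn-injective v x y
    ; preserves = id ; reflects = id }

  punched : ∀ {x} → v ≢ x → ∃ λ i → x ≡ in-v i
  punched v≢x = punchOut v≢x , ≡-sym (punchIn-punchOut v≢x)

  delete-Acyclic : Acyclic T → Acyclic (delete T v)
  delete-Acyclic acyc (x ∷ xs) (u , 3≤ , p) = acyc (map in-v (x ∷ xs))
    ( Unique.map⁺ (λ {i} {j} → punchIn-injective v i j) u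
    , subst (3 ≤_) (≡-sym (length-map in-v (x ∷ xs))) 3≤
    , path xs p )
    where
    path : ∀ {a z} bs → PathAdj (delete T v) a bs z → PathAdj T (in-v a) (map in-v bs) (in-v z)
    path []       e       = e
    path (b ∷ bs) (e , p) = e , path bs p

  module _ (leaf : IsLeaf T v) where

    private
      u : Fin (suc n)
      u = proj₁ leaf
      vu : Adj T v u
      vu = proj₁ (proj₂ leaf)
      only : ∀ w → Adj T v w → w ≡ u
      only = proj₂ (proj₂ leaf)

    -- A visit of the walk to v comes from u and returns to u; skip it.
    avoid : ∀ {a b} i j → a ≡ in-v i → b ≡ in-v j → Walk T a b → Walk (delete T v) i j
    avoid i j p q here with punchIn-injective v i j (trans (≡-sym p) q)
    ... | refl = here
    avoid i j p q (step {v = x} e w) with v Fin.≟ x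
    ... | no v≢x with punched v≢x
    ...   | k , refl = step (subst (λ a → Adj T a (in-v k)) p e) (avoid k j refl q w)
    avoid i j p q (step e here) | yes refl = ⊥-elim (punchInᵢ≢i v j (≡-sym q))
    avoid i j p q (step e (step e′ w)) | yes refl =
      avoid i j (trans (only _ e′) (trans (≡-sym (only _ (Adj-sym T e))) p)) q w

    delete-IsTree : IsTree T → IsTree (delete T v)
    delete-IsTree (conn , acyc) =
      (λ i j → avoid i j refl refl (conn (in-v i) (in-v j))) , delete-Acyclic acyc

    leaf-nbr : Fin n
    leaf-nbr = proj₁ (punched {u} λ { refl → Adj-irrefl T vu })

    leaf-nbr-≡ : u ≡ in-v leaf-nbr
    leaf-nbr-≡ = proj₂ (punched {u} λ { refl → Adj-irrefl T vu })

    private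
      unpunch : Maybe (Fin n) → Fin (suc n)
      unpunch (just i) = in-v i
      unpunch nothing  = v

    unpunch-↪ : Add (Adj (delete T v)) leaf-nbr ↪ Adj T
    unpunch-↪ = record { emb = unpunch ; injective = inj ; preserves = pre ; reflects = ref }
      where
      inj : ∀ {x y} → unpunch x ≡ unpunch y → x ≡ y
      inj {just i} {just j} eq = cong just (punchIn-injective v i j eq)
      inj {just i} {nothing} eq = ⊥-elim (punchInᵢ≢i v i eq)
      inj {nothing} {just j} eq = ⊥-elim (punchInᵢ≢i v j (≡-sym eq))
      inj {nothing} {nothing} _ = refl
      vq : Adj T v (in-v leaf-nbr)
      vq = subst (Adj T v) leaf-nbr-≡ vu
      only-q : ∀ {i} → Adj T v (in-v i) → i ≡ leaf-nbr
      only-q {i} e = punchIn-injective v i leaf-nbr (trans (only _ e) leaf-nbr-≡)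
      pre : ∀ {x y} → Add (Adj (delete T v)) leaf-nbr x y → Adj T (unpunch x) (unpunch y)
      pre (old e) = e
      pre fwd     = Adj-sym T vq
      pre bwd     = vq
      ref : ∀ {x y} → Adj T (unpunch x) (unpunch y) → Add (Adj (delete T v)) leaf-nbr x y
      ref {just i} {just j} e = old e
      ref {just i} {nothing} e with only-q (Adj-sym T e)
      ... | refl = fwd
      ref {nothing} {just j} e with only-q e
      ... | refl = bwd
      ref {nothing} {nothing} e = ⊥-elim (Adj-irrefl T e)

    delete-leaf-≃ : Adj T ≃ Add (Adj (delete T v)) leaf-nbr
    delete-leaf-≃ = ≃-sym (↪-surjective⇒≃ unpunch-↪ sur)
      where
      sur : ∀ x → ∃ λ m → x ≡ unpunch m
      sur x with v Fin.≟ x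
      ... | yes refl = nothing , refl
      ... | no v≢x with punched v≢x
      ...   | i , eq = just i , eq

  -- Works against the direction of `delete-leaf-≃`: a deletion in the tree model becomes a leaf
  -- deletion in the graph.
  leaf-of-Add : ∀ {A : Set} {R : A → A → Set} {q} (θ : Adj T ≃ Add R q) →
                from θ nothing ≡ v → IsLeaf T v × Adj (delete T v) ≃ R
  leaf-of-Add {R = R} {q} θ refl = 
    (from θ (just q) , pres⁻ θ bwd , only) , restrict delete-↪ just-↪ θ f g
    where
    only : ∀ w → Adj T v w → w ≡ from θ (just q)
    only w e with to θ w in eq | subst (λ z → Add R q z (to θ w)) (to-from θ nothing) (pres θ e)
    ... | just _ | bwd = ≡-sym (from-≡ θ eq)
    f : ∀ i → ∃ λ a → to θ (in-v i) ≡ just a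
    f i with to θ (in-v i) in eq
    ... | just a  = a , refl
    ... | nothing = ⊥-elim (punchInᵢ≢i v i (≡-sym (from-≡ θ eq)))
    g : ∀ a → ∃ λ i → from θ (just a) ≡ in-v i
    g a = punched λ eq → nothing≢just (trans (≡-sym (to-from θ nothing))
                                        (trans (cong (to θ) eq) (to-from θ (just a))))
      where
      nothing≢just : ∀ {a} → ¬ nothing ≡ just a
      nothing≢just ()

-- From graphs to rooted trees.

-- By induction: a leaf is deleted and then hung back with `attach` at the image of its neighbour.
tree-shape : ∀ n (T : Graph (suc n)) → IsTree T → ∃ λ t → Adj T ≃ E {t}
tree-shape zero T _ = • , record
  { to      = λ _ → pt
  ; from    = λ _ → zero
  ; to-from = λ { pt → refl }
  ; from-to = λ { zero → refl }
  ; pres    = λ { {zero} {zero} e → ⊥-elim (Adj-irrefl T e) }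
  ; pres⁻   = λ () }
tree-shape (suc n) T tree with leaf-exists T tree
... | v , leaf with tree-shape n (delete T v) (delete-IsTree T v leaf tree)
...   | t , φ = attach q ,
  ≃-trans (delete-leaf-≃ T v leaf) (≃-trans (Add-cong φ) (proj₁ (attach-≃ q)))
  where
  q : V t
  q = to φ (leaf-nbr T v leaf)

-- Identification of the spider with `E7`, by evaluation.

root? : ∀ {t} (x : V t) → Dec (x ≡ root t)
root? pt      = yes refl
root? (inl x) = no λ ()
root? (inr x) = map′ (cong inr) inr-injective (root? x)

E? : ∀ {t} (x y : V t) → Dec (E x y)
E? pt      pt      = no λ ()
E? (inl x) (inl y) = map′ left (λ { (left e) → e }) (E? x y)
E? (inr x) (inr y) = map′ right (λ { (right e) → e }) (E? x y)
E? (inl x) (inr y) =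
  map′ (λ { (p , q) → up p q }) (λ { (up p q) → p , q }) (root? x ×-dec root? y)
E? (inr x) (inl y) =
  map′ (λ { (p , q) → down p q }) (λ { (down p q) → p , q }) (root? y ×-dec root? x)

spider₁₂₃≃E7 : E {spider₁₂₃} ≃ Adj E7
spider₁₂₃≃E7 = ≃-sym (↪-surjective⇒≃ record
  { emb = at ; injective = inj ; preserves = pre ; reflects = ref } sur)
  where
  at : Fin 7 → V spider₁₂₃
  at 0F = inr (inr (inr pt))
  at 1F = inr (inl pt)
  at 2F = inr (inr (inl (inr pt)))
  at 3F = inr (inr (inl (inl pt)))
  at 4F = inl (inr pt)
  at 5F = inl (inl (inr pt))
  at 6F = inl (inl (inl pt))
  sur : ∀ x → ∃ λ i → x ≡ at i
  sur (inr (inr (inr pt)))       = 0F , refl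
  sur (inr (inl pt))             = 1F , refl
  sur (inr (inr (inl (inr pt)))) = 2F , refl
  sur (inr (inr (inl (inl pt)))) = 3F , refl
  sur (inl (inr pt))             = 4F , refl
  sur (inl (inl (inr pt)))       = 5F , refl
  sur (inl (inl (inl pt)))       = 6F , refl
  retract : ∀ i → proj₁ (sur (at i)) ≡ i
  retract = from-yes (all? λ i → proj₁ (sur (at i)) Fin.≟ i)
  inj : ∀ {i j} → at i ≡ at j → i ≡ j
  inj {i} {j} eq = trans (≡-sym (retract i)) (trans (cong (proj₁ ∘ sur) eq) (retract j))
  pre : ∀ {i j} → Adj E7 i j → E (at i) (at j)
  pre {i} {j} = from-yes (all? λ i → all? λ j → (adj E7 i j Bool.≟ true) →-dec E? (at i) (at j)) i j
  ref : ∀ {i j} → E (at i) (at j) → Adj E7 i j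
  ref {i} {j} = from-yes (all? λ i → all? λ j → E? (at i) (at j) →-dec (adj E7 i j Bool.≟ true)) i j

-- Minimal elements are stuck, and the conclusion.

-- An asymmetric deletion would carry over to a graph `T′` below `T`, and minimality would equate
-- their numbers of vertices. With `3 + n` vertices in `T`, `T′` keeps the two that `AFT` asks for.
minimal⇒Stuck : ∀ {n} (T : Graph (3 + n)) → Minimal T → ∀ {t} → Adj T ≃ E {t} → Stuck t
minimal⇒Stuck {n} T ((_ , tree , _) , minimal) φ {r′ = r′} t~r (q , r≈attach) af =
  1+n≢n (≡-sym (↔⇒≡ (proj₁ (minimal T′ aft (del v leaf aft (done (≃⇒≅ {G = T′} {T′} ≃-refl)))))))
  where
  θ : Adj T ≃ Add (E {r′}) q
  θ = ≃-trans φ (≃-trans t~r (≃-trans (iso r≈attach) (≃-sym (proj₁ (attach-≃ q)))))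
  v : Fin (3 + n)
  v = from θ nothing
  leaf : IsLeaf T v
  leaf = proj₁ (leaf-of-Add T v θ refl)
  T′ : Graph (2 + n)
  T′ = delete T v
  aft : AFT T′
  aft = s≤s (s≤s z≤n) , delete-IsTree T v leaf tree ,
        AF⇒AutomorphismFree {G = T′}
          (AF-resp-≃ (≃-sym (proj₂ (leaf-of-Add T v θ refl))) af)

theorem1p1 : ∀ {n} (T : Graph n) → Minimal T → T ≅ E7
theorem1p1 {suc n} T min@((2≤n , tree , free) , _) with tree-shape n T tree
theorem1p1 {1} T ((s≤s () , _) , _) | _
theorem1p1 {2} T ((_ , _ , free) , _) | t , φ with size≡2⇒stem₂ t (≡-sym (size-unique φ))
-- The ends of a single edge can be swapped.
... | refl = ⊥-elim (AF-halves (AF-resp-≃ φ (AutomorphismFree⇒AF {G = T} free)) ≈-refl)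
theorem1p1 {suc (suc (suc n))} T min@((2≤n , _ , free) , _) | t , φ =
  ≃⇒≅ {G = T} {E7} (≃-trans φ (≃-trans
    (stuck⇒spider₁₂₃ t (subst (2 ≤_) (size-unique φ) 2≤n)
      (AF-resp-≃ φ (AutomorphismFree⇒AF {G = T} free)) (minimal⇒Stuck T min φ))
    spider₁₂₃≃E7))
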